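{- Let $L$ be any one of the sequent calculi $\mathrm{LJ}^+$, $\mathrm{sC}$, $\mathrm{sC3}$, $\mathrm{sMC}$, $\mathrm{sCN}$. The weakening rule (we), "from $\Gamma\Rightarrow\gamma$ infer $\alpha,\Gamma\Rightarrow\gamma$", is admissible in cut-free $L$; that is, for every finite set $\Gamma$ of formulas and all formulas $\alpha,\gamma$ (in the language of $L$), if $\Gamma\Rightarrow\gamma$ is provable in $L-(\mathrm{cut})$, then $\alpha,\Gamma\Rightarrow\gamma$ is provable in $L-(\mathrm{cut})$.
   Context: Formulas of $\mathrm{sC},\mathrm{sC3},\mathrm{sMC},\mathrm{sCN}$ are built from countably many propositional variables $p,q,\dots$ using the binary connectives $\land,\lor,\to$ and the unary connective $\sim$; the language of $\mathrm{LJ}^+$ (positive intuitionistic logic) has only $\land,\lor,\to$ and no $\sim$. A sequent is an expression $\Gamma\Rightarrow\gamma$ with $\Gamma$ a finite (possibly empty) set of formulas and $\gamma$ a single formula; $\alpha,\Gamma$ means $\{\alpha\}\cup\Gamma$ and $\Gamma,\Delta$ means $\Gamma\cup\Delta$. $L-(\mathrm{cut})$ ("cut-free $L$") is $L$ without the rule (cut). Below, $p$ is any propositional variable, $\alpha,\beta,\gamma$ any formulas, $\Gamma,\Delta,\Sigma$ any finite sets of formulas. $\mathrm{LJ}^+$ has initial sequents (init1) $p,\Gamma\Rightarrow p$ and rules: (cut): from $\Gamma\Rightarrow\alpha$ and $\alpha,\Sigma\Rightarrow\gamma$ infer $\Gamma,\Sigma\Rightarrow\gamma$. ($\to$left): from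 $\Gamma\Rightarrow\alpha$ and $\beta,\Delta\Rightarrow\gamma$ infer $\alpha\to\beta,\Gamma,\Delta\Rightarrow\gamma$. ($\to$right): from $\alpha,\Gamma\Rightarrow\beta$ infer $\Gamma\Rightarrow\alpha\to\beta$. ($\land$left): from $\alpha,\beta,\Gamma\Rightarrow\gamma$ infer $\alpha\land\beta,\Gamma\Rightarrow\gamma$. ($\land$right): from $\Gamma\Rightarrow\alpha$ and $\Gamma\Rightarrow\beta$ infer $\Gamma\Rightarrow\alpha\land\beta$. ($\lor$left): from $\alpha,\Gamma\Rightarrow\gamma$ and $\beta,\Gamma\Rightarrow\gamma$ infer $\alpha\lor\beta,\Gamma\Rightarrow\gamma$. ($\lor$right1), ($\lor$right2): from $\Gamma\Rightarrow\alpha$ (respectively $\Gamma\Rightarrow\beta$) infer $\Gamma\Rightarrow\alpha\lor\beta$. $\mathrm{sC}$ is $\mathrm{LJ}^+$ (over the full language) plus initial sequents (init2) $\sim p,\Gamma\Rightarrow\sim p$ and rules: ($\sim$left): from $\alpha,\Gamma\Rightarrow\gamma$ infer $\sim\sim\alpha,\Gamma\Rightarrow\gamma$. ($\sim$right): from $\Gamma\Rightarrow\alpha$ infer $\Gamma\Rightarrow\sim\sim\alpha$. ($\sim\to$left): from $\Gamma\Rightarrow\alpha$ and $\sim\beta,\Delta\Rightarrow\gamma$ infer $\sim(\alpha\to\beta),\Gamma,\Delta\Rightarrow\gamma$. ($\sim\to$right): from $\alpha,\Gamma\Rightarrow\sim\beta$ infer $\Gamma\Rightarrow\sim(\alpha\to\beta)$.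 ($\sim\land$left): from $\sim\alpha,\Gamma\Rightarrow\gamma$ and $\sim\beta,\Gamma\Rightarrow\gamma$ infer $\sim(\alpha\land\beta),\Gamma\Rightarrow\gamma$. ($\sim\land$right1), ($\sim\land$right2): from $\Gamma\Rightarrow\sim\alpha$ (respectively $\Gamma\Rightarrow\sim\beta$) infer $\Gamma\Rightarrow\sim(\alpha\land\beta)$. ($\sim\lor$left): from $\sim\alpha,\sim\beta,\Gamma\Rightarrow\gamma$ infer $\sim(\alpha\lor\beta),\Gamma\Rightarrow\gamma$. ($\sim\lor$right): from $\Gamma\Rightarrow\sim\alpha$ and $\Gamma\Rightarrow\sim\beta$ infer $\Gamma\Rightarrow\sim(\alpha\lor\beta)$. Additional rules: (ex-middle): from $\sim\alpha,\Gamma\Rightarrow\gamma$ and $\alpha,\Gamma\Rightarrow\gamma$ infer $\Gamma\Rightarrow\gamma$. (Peirce): from $\alpha\to\beta,\Gamma\Rightarrow\alpha$ infer $\Gamma\Rightarrow\alpha$. $\mathrm{sC3}=\mathrm{sC}+$(ex-middle); $\mathrm{sMC}=\mathrm{sC}+$(Peirce); $\mathrm{sCN}=\mathrm{sC3}+$(Peirce). -}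

module Defs where

open import Data.Nat using (ℕ)
open import Data.List using (List; []; _∷_; _++_)
open import Data.List.Relation.Unary.All using (All)
open import Data.List.Relation.Binary.BagAndSetEquality using (_∼[_]_; set)

data Language : Set where
  positive full : Language

infixr 7 _∧_
infixr 6 _∨_
infixr 5 _⟶_
infix  8 ∼_

data Formula : Language → Set where
  var : ∀ {ℓ} → ℕ → Formula ℓ
  _∧_ _∨_ _⟶_ : ∀ {ℓ} → Formula ℓ → Formula ℓ → Formula ℓ
  ∼_  : Formula full → Formula full

-- Finite sets of formulas are represented by lists: {α} ∪ Γ is α ∷ Γ and
-- Γ ∪ Δ is Γ ++ Δ.  Lists with the same members denote the same set; see
-- Provable below.
Context : Language → Set
Context ℓ = List (Formula ℓ)

infix 3 _⇒_

data Sequent (ℓ : Language) : Set where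
  _⇒_ : Context ℓ → Formula ℓ → Sequent ℓ

data Calculus : Language → Set where
  LJ⁺            : Calculus positive
  sC sC3 sMC sCN : Calculus full

data HasExMiddle : Calculus full → Set where
  sC3 : HasExMiddle sC3
  sCN : HasExMiddle sCN

data HasPeirce : Calculus full → Set where
  sMC : HasPeirce sMC
  sCN : HasPeirce sCN

data CutMode : Set where
  with-cut cut-free : CutMode

-- Inference L c Ps S: the sequent S follows from the list of premises Ps by
-- one application of a rule of L (c = with-cut) or of L − (cut)
-- (c = cut-free).  Initial sequents are the rules without premises.  The
-- rules for ∼ are in every calculus over the full language, since each of
-- these extends sC.
data Inference : ∀ {ℓ} → Calculus ℓ → CutMode → List (Sequent ℓ) → Sequent ℓ → Set where

  init1   : ∀ {ℓ c} {L : Calculus ℓ} {p Γ} →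
            Inference L c [] (var p ∷ Γ ⇒ var p)

  cut     : ∀ {ℓ} {L : Calculus ℓ} {Γ Σ α γ} →
            Inference L with-cut ((Γ ⇒ α) ∷ (α ∷ Σ ⇒ γ) ∷ []) (Γ ++ Σ ⇒ γ)

  ⟶left   : ∀ {ℓ c} {L : Calculus ℓ} {Γ Δ α β γ} →
            Inference L c ((Γ ⇒ α) ∷ (β ∷ Δ ⇒ γ) ∷ []) ((α ⟶ β) ∷ Γ ++ Δ ⇒ γ)
  ⟶right  : ∀ {ℓ c} {L : Calculus ℓ} {Γ α β} →
            Inference L c ((α ∷ Γ ⇒ β) ∷ []) (Γ ⇒ α ⟶ β)

  ∧left   : ∀ {ℓ c} {L : Calculus ℓ} {Γ α β γ} →
            Inference L c ((α ∷ β ∷ Γ ⇒ γ) ∷ []) ((α ∧ β) ∷ Γ ⇒ γ)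
  ∧right  : ∀ {ℓ c} {L : Calculus ℓ} {Γ α β} →
            Inference L c ((Γ ⇒ α) ∷ (Γ ⇒ β) ∷ []) (Γ ⇒ α ∧ β)

  ∨left   : ∀ {ℓ c} {L : Calculus ℓ} {Γ α β γ} →
            Inference L c ((α ∷ Γ ⇒ γ) ∷ (β ∷ Γ ⇒ γ) ∷ []) ((α ∨ β) ∷ Γ ⇒ γ)
  ∨right1 : ∀ {ℓ c} {L : Calculus ℓ} {Γ α β} →
            Inference L c ((Γ ⇒ α) ∷ []) (Γ ⇒ α ∨ β)
  ∨right2 : ∀ {ℓ c} {L : Calculus ℓ} {Γ α β} →
            Inference L c ((Γ ⇒ β) ∷ []) (Γ ⇒ α ∨ β)

  init2    : ∀ {c} {L : Calculus full} {p Γ} →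
             Inference L c [] (∼ var p ∷ Γ ⇒ ∼ var p)

  ∼left    : ∀ {c} {L : Calculus full} {Γ α γ} →
             Inference L c ((α ∷ Γ ⇒ γ) ∷ []) (∼ ∼ α ∷ Γ ⇒ γ)
  ∼right   : ∀ {c} {L : Calculus full} {Γ α} →
             Inference L c ((Γ ⇒ α) ∷ []) (Γ ⇒ ∼ ∼ α)

  ∼⟶left   : ∀ {c} {L : Calculus full} {Γ Δ α β γ} →
             Inference L c ((Γ ⇒ α) ∷ (∼ β ∷ Δ ⇒ γ) ∷ []) (∼ (α ⟶ β) ∷ Γ ++ Δ ⇒ γ)
  ∼⟶right  : ∀ {c} {L : Calculus full} {Γ α β} →
             Inference L c ((α ∷ Γ ⇒ ∼ β) ∷ []) (Γ ⇒ ∼ (α ⟶ β))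

  ∼∧left   : ∀ {c} {L : Calculus full} {Γ α β γ} →
             Inference L c ((∼ α ∷ Γ ⇒ γ) ∷ (∼ β ∷ Γ ⇒ γ) ∷ []) (∼ (α ∧ β) ∷ Γ ⇒ γ)
  ∼∧right1 : ∀ {c} {L : Calculus full} {Γ α β} →
             Inference L c ((Γ ⇒ ∼ α) ∷ []) (Γ ⇒ ∼ (α ∧ β))
  ∼∧right2 : ∀ {c} {L : Calculus full} {Γ α β} →
             Inference L c ((Γ ⇒ ∼ β) ∷ []) (Γ ⇒ ∼ (α ∧ β))

  ∼∨left   : ∀ {c} {L : Calculus full} {Γ α β γ} →
             Inference L c ((∼ α ∷ ∼ β ∷ Γ ⇒ γ) ∷ []) (∼ (α ∨ β) ∷ Γ ⇒ γ)
  ∼∨right  : ∀ {c} {L : Calculus full} {Γ α β} →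
             Inference L c ((Γ ⇒ ∼ α) ∷ (Γ ⇒ ∼ β) ∷ []) (Γ ⇒ ∼ (α ∨ β))

  ex-middle : ∀ {c} {L : Calculus full} {Γ α γ} → HasExMiddle L →
              Inference L c ((∼ α ∷ Γ ⇒ γ) ∷ (α ∷ Γ ⇒ γ) ∷ []) (Γ ⇒ γ)

  Peirce    : ∀ {c} {L : Calculus full} {Γ α β} → HasPeirce L →
              Inference L c (((α ⟶ β) ∷ Γ ⇒ α) ∷ []) (Γ ⇒ α)

-- The conclusion of an inference may be rewritten to any sequent whose
-- antecedent is the same set, so provability depends only on the set denoted
-- by the antecedent.
data Provable {ℓ} (L : Calculus ℓ) (c : CutMode) : Sequent ℓ → Set where
  infer : ∀ {Ps Γ Δ γ} → Inference L c Ps (Γ ⇒ γ) → All (Provable L c) Ps →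
          Γ ∼[ set ] Δ → Provable L c (Δ ⇒ γ)

{-# OPTIONS --safe #-}
module Submission where

-- Provability is monotone in the antecedent: every rule keeps its side
-- formulas in its premises, so all of them can be enlarged to the target set
-- Θ, and the principal formula, already a member of Θ, is then absorbed.
-- Stating monotonicity for arbitrary supersets makes the induction go through
-- rules that add formulas to the antecedent and those that split it.

open import Data.List using (List; []; _∷_; _++_)
open import Data.List.Membership.Propositional using (_∈_)
open import Data.List.Relation.Binary.BagAndSetEquality using (_∼[_]_; set; ++-idempotent)
open import Data.List.Relation.Binary.Subset.Propositional using (_⊆_)
open import Data.List.Relation.Binary.Subset.Propositional.Properties using (∷⁺ʳ; ∈-∷⁺ʳ; xs⊆x∷xs; xs⊆xs++ys; xs⊆ys++xs)
open import Data.List.Relation.Unary.All using (All; []; _∷_)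
open import Data.List.Relation.Unary.Any using (here; there)
open import Function using (_∘_; id)
open import Function.Bundles using (Equivalence; mk⇔)
open import Relation.Binary.PropositionalEquality using (refl)
open import Defs

∷-absorb : ∀ {A : Set} {x : A} {xs ys : List A} →
           x ∈ ys → xs ∼[ set ] ys → x ∷ xs ∼[ set ] ys
∷-absorb x∈ys xs∼ys =
  mk⇔ (∈-∷⁺ʳ x∈ys (Equivalence.to xs∼ys)) (there ∘ Equivalence.from xs∼ys)

-- Reapplying a left rule or an initial sequent over `Θ` puts the principal formula in front of `Θ`;
-- this turns that conclusion back into `Θ`.
principal-absorb : ∀ {ℓ} {Γ Θ : Context ℓ} {α} → α ∷ Γ ⊆ Θ → α ∷ Θ ∼[ set ] Θ
principal-absorb s = ∷-absorb (s (here refl)) (mk⇔ id id)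

-- For rules that split the antecedent: both premises receive all of `Θ`, so the conclusion carries
-- two copies of it.
principal-absorb-++ : ∀ {ℓ} {Γ Θ : Context ℓ} {α} → α ∷ Γ ⊆ Θ → α ∷ Θ ++ Θ ∼[ set ] Θ
principal-absorb-++ {Θ = Θ} s = ∷-absorb (s (here refl)) (++-idempotent Θ)

mutual

  Provable-mono : ∀ {ℓ} {L : Calculus ℓ} {c Γ Θ γ} →
                  Provable L c (Γ ⇒ γ) → Γ ⊆ Θ → Provable L c (Θ ⇒ γ)
  -- The stored set equality is merged into the inclusion, leaving only the bare inference to treat.
  Provable-mono (infer r ps Γ∼Δ) Δ⊆Θ = infer-mono r ps (Δ⊆Θ ∘ Equivalence.to Γ∼Δ)

  infer-mono : ∀ {ℓ} {L : Calculus ℓ} {c Ps Γ Θ γ} →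
               Inference L c Ps (Γ ⇒ γ) → All (Provable L c) Ps →
               Γ ⊆ Θ → Provable L c (Θ ⇒ γ)
  infer-mono init1 [] s = infer init1 [] (principal-absorb s)
  -- The cut formula is absent from the conclusion, so only the doubled `Θ` has to be contracted.
  infer-mono {Θ = Θ} (cut {Γ = Γ} {Σ = Σ}) (p ∷ q ∷ []) s =
    infer cut (Provable-mono p (s ∘ xs⊆xs++ys Γ Σ) ∷ extend q (s ∘ xs⊆ys++xs Σ Γ) ∷ [])
          (++-idempotent Θ)
  infer-mono (⟶left {Γ = Γ} {Δ = Δ}) (p ∷ q ∷ []) s =
    infer ⟶left (Provable-mono p (s ∘ there ∘ xs⊆xs++ys Γ Δ) ∷ extend q (s ∘ there ∘ xs⊆ys++xs Δ Γ) ∷ [])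
          (principal-absorb-++ s)
  infer-mono ⟶right (p ∷ []) s = infer ⟶right (extend p s ∷ []) (mk⇔ id id)
  -- `there` skips the principal formula, leaving the inclusion of the side formulas alone.
  infer-mono ∧left (p ∷ []) s = infer ∧left (extend₂ p (s ∘ there) ∷ []) (principal-absorb s)
  infer-mono ∧right (p ∷ q ∷ []) s =
    infer ∧right (Provable-mono p s ∷ Provable-mono q s ∷ []) (mk⇔ id id)
  infer-mono ∨left (p ∷ q ∷ []) s =
    infer ∨left (extend p (s ∘ there) ∷ extend q (s ∘ there) ∷ []) (principal-absorb s)
  infer-mono ∨right1 (p ∷ []) s = infer ∨right1 (Provable-mono p s ∷ []) (mk⇔ id id)
  infer-mono ∨right2 (p ∷ []) s = infer ∨right2 (Provable-mono p s ∷ []) (mk⇔ id id)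
  infer-mono init2 [] s = infer init2 [] (principal-absorb s)
  infer-mono ∼left (p ∷ []) s = infer ∼left (extend p (s ∘ there) ∷ []) (principal-absorb s)
  infer-mono ∼right (p ∷ []) s = infer ∼right (Provable-mono p s ∷ []) (mk⇔ id id)
  infer-mono (∼⟶left {Γ = Γ} {Δ = Δ}) (p ∷ q ∷ []) s =
    infer ∼⟶left (Provable-mono p (s ∘ there ∘ xs⊆xs++ys Γ Δ) ∷ extend q (s ∘ there ∘ xs⊆ys++xs Δ Γ) ∷ [])
          (principal-absorb-++ s)
  infer-mono ∼⟶right (p ∷ []) s = infer ∼⟶right (extend p s ∷ []) (mk⇔ id id)
  infer-mono ∼∧left (p ∷ q ∷ []) s =
    infer ∼∧left (extend p (s ∘ there) ∷ extend q (s ∘ there) ∷ []) (principal-absorb s)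
  infer-mono ∼∧right1 (p ∷ []) s = infer ∼∧right1 (Provable-mono p s ∷ []) (mk⇔ id id)
  infer-mono ∼∧right2 (p ∷ []) s = infer ∼∧right2 (Provable-mono p s ∷ []) (mk⇔ id id)
  infer-mono ∼∨left (p ∷ []) s = infer ∼∨left (extend₂ p (s ∘ there) ∷ []) (principal-absorb s)
  infer-mono ∼∨right (p ∷ q ∷ []) s =
    infer ∼∨right (Provable-mono p s ∷ Provable-mono q s ∷ []) (mk⇔ id id)
  infer-mono (ex-middle h) (p ∷ q ∷ []) s =
    infer (ex-middle h) (extend p s ∷ extend q s ∷ []) (mk⇔ id id)
  infer-mono (Peirce h) (p ∷ []) s = infer (Peirce h) (extend p s ∷ []) (mk⇔ id id)

  -- An active formula of a premise need not belong to `Θ`, so it is kept in front on both sides.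
  -- The derivation is passed on unchanged, so the recursion stays structural.
  extend : ∀ {ℓ} {L : Calculus ℓ} {c Γ Θ α γ} →
           Provable L c (α ∷ Γ ⇒ γ) → Γ ⊆ Θ → Provable L c (α ∷ Θ ⇒ γ)
  extend p s = Provable-mono p (∷⁺ʳ _ s)

  extend₂ : ∀ {ℓ} {L : Calculus ℓ} {c Γ Θ α β γ} →
            Provable L c (α ∷ β ∷ Γ ⇒ γ) → Γ ⊆ Θ → Provable L c (α ∷ β ∷ Θ ⇒ γ)
  extend₂ p s = Provable-mono p (∷⁺ʳ _ (∷⁺ʳ _ s))

proposition2p4 : ∀ {ℓ} (L : Calculus ℓ) (Γ : Context ℓ) (α γ : Formula ℓ) →
    Provable L cut-free (Γ ⇒ γ) → Provable L cut-free (α ∷ Γ ⇒ γ)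
proposition2p4 L Γ α γ p = Provable-mono p (xs⊆x∷xs Γ α)
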